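{- For every $n\ge 3$, $strc(C_n)=trc(C_n)$, where $C_n$ is the cycle of order $n$. Explicitly, $strc(C_n)$ equals $1,3,3,5,6,7,8,9,11,11$ for $n=3,4,5,6,7,8,9,10,11,12$ respectively, and $strc(C_n)=n$ for $n\ge 13$.
   Context: All graphs are finite and simple. A total-coloured path (vertices and edges coloured) is total-rainbow if its edges and internal vertices have pairwise distinct colours. $trc(G)$ is the minimum number of colours in a total-colouring of $G$ in which any two vertices are joined by a total-rainbow path; $strc(G)$ is the minimum number of colours in a total-colouring in which any two vertices $u,v$ are joined by a total-rainbow $u$–$v$ geodesic (a $u$–$v$ path of length $d(u,v)$). -}

module Defs where

open import Data.Nat using (ℕ; zero; suc; _≤_; _∸_)
open import Data.Fin using (Fin; toℕ)
open import Data.List using (List; []; _∷_; _++_; map; length; head; last)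
open import Data.Maybe using (just)
open import Data.Product using (Σ; _×_; ∃)
open import Data.Sum using (_⊎_)
open import Relation.Nullary using (¬_)
open import Relation.Binary.PropositionalEquality using (_≡_)
open import Data.List.Relation.Unary.Linked using (Linked)
open import Data.List.Relation.Unary.Unique.Propositional using (Unique)

-- A (simple) graph on vertex set Fin n is given by its adjacency relation.
Rel : ℕ → Set₁
Rel n = Fin n → Fin n → Set

-- Cycle C_n on vertices 0,…,n-1 : i ~ i+1 and n-1 ~ 0 (simple when n ≥ 3).
Succ : (n : ℕ) → Rel n
Succ n i j = (suc (toℕ i) ≡ toℕ j) ⊎ (suc (toℕ i) ≡ n × toℕ j ≡ 0)

Cycle : (n : ℕ) → Rel n
Cycle n i j = Succ n i j ⊎ Succ n j i

IsPath : {n : ℕ} → Rel n → Fin n → Fin n → List (Fin n) → Set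
IsPath Adj u v ps = Linked Adj ps × Unique ps × head ps ≡ just u × last ps ≡ just v

pathLength : {A : Set} → List A → ℕ
pathLength ps = length ps ∸ 1

edgeCols : {n k : ℕ} → (Fin n → Fin n → Fin k) → List (Fin n) → List (Fin k)
edgeCols ec (x ∷ y ∷ r) = ec x y ∷ edgeCols ec (y ∷ r)
edgeCols ec _ = []

dropLast : {A : Set} → List A → List A
dropLast [] = []
dropLast (x ∷ []) = []
dropLast (x ∷ y ∷ r) = x ∷ dropLast (y ∷ r)

internal : {A : Set} → List A → List A
internal [] = []
internal (x ∷ r) = dropLast r

TotalRainbow : {n k : ℕ} → (Fin n → Fin k) → (Fin n → Fin n → Fin k) → List (Fin n) → Set
TotalRainbow vc ec ps = Unique (edgeCols ec ps ++ map vc (internal ps))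

IsGeodesic : {n : ℕ} → Rel n → Fin n → Fin n → List (Fin n) → Set
IsGeodesic Adj u v ps =
  IsPath Adj u v ps × (∀ qs → IsPath Adj u v qs → pathLength ps ≤ pathLength qs)

-- A total-colouring with k colours: vertex colouring vc and edge colouring ec
-- (ec is symmetric, i.e. an edge uv gets a single colour).
-- Total-rainbow connected with k colours:
TRConnectedWith : (n : ℕ) → Rel n → ℕ → Set
TRConnectedWith n Adj k =
  Σ (Fin n → Fin k) λ vc → Σ (Fin n → Fin n → Fin k) λ ec →
    (∀ u v → ec u v ≡ ec v u) ×
    (∀ u v → ¬ u ≡ v → ∃ λ ps → IsPath Adj u v ps × TotalRainbow vc ec ps)

STRConnectedWith : (n : ℕ) → Rel n → ℕ → Set
STRConnectedWith n Adj k =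
  Σ (Fin n → Fin k) λ vc → Σ (Fin n → Fin n → Fin k) λ ec →
    (∀ u v → ec u v ≡ ec v u) ×
    (∀ u v → ¬ u ≡ v → ∃ λ ps → IsGeodesic Adj u v ps × TotalRainbow vc ec ps)

IsMinimum : (ℕ → Set) → ℕ → Set
IsMinimum P k = P k × (∀ m → P m → k ≤ m)

trcIs : (n : ℕ) → Rel n → ℕ → Set
trcIs n Adj = IsMinimum (TRConnectedWith n Adj)

strcIs : (n : ℕ) → Rel n → ℕ → Set
strcIs n Adj = IsMinimum (STRConnectedWith n Adj)

cycleValue : ℕ → ℕ
cycleValue 3 = 1
cycleValue 4 = 3
cycleValue 5 = 3
cycleValue 6 = 5
cycleValue 7 = 6
cycleValue 8 = 7
cycleValue 9 = 8
cycleValue 10 = 9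
cycleValue 11 = 11
cycleValue 12 = 11
cycleValue n = n

{-# OPTIONS --safe #-}
module Submission where

open import Defs
open import Data.Fin using (Fin; toℕ)
import Data.Fin as Fin
import Data.Fin.Properties as Fin
open import Data.List using (List; []; _∷_; _++_; map; length; head; last; lookup; upTo; applyUpTo; applyDownFrom)
open import Data.List.Membership.Propositional.Properties using (∈-lookup)
open import Data.List.Properties
open import Data.List.Relation.Binary.Permutation.Propositional using (_↭_; prep; ↭-sym; ↭-trans; ↭-refl; ↭-reflexive; ↭⇒↭ₛ)
open import Data.List.Relation.Binary.Permutation.Propositional.Properties using (shift; ↭-reverse; ++⁺)
import Data.List.Relation.Binary.Permutation.Setoid.Properties as Permutation
open import Data.List.Relation.Unary.All as All using (_∷_)
import Data.List.Relation.Unary.All.Properties as All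
open import Data.List.Relation.Unary.AllPairs using (_∷_)
open import Data.List.Relation.Unary.Linked using (Linked; []; [-]; _∷_)
import Data.List.Relation.Unary.Linked.Properties as Linked
open import Data.List.Relation.Unary.Unique.Propositional using (Unique)
import Data.List.Relation.Unary.Unique.Propositional.Properties as Unique
open import Data.Maybe using (just)
open import Data.Maybe.Properties using (just-injective)
open import Data.Nat
open import Data.Nat.DivMod
open import Data.Nat.Divisibility
open import Data.Nat.Properties
open import Data.Nat.Solver using (module +-*-Solver)
open import Data.Product using (_×_; _,_; proj₁; proj₂; ∃; ∃₂; swap)
open import Data.Sum as Sum using (_⊎_; inj₁; inj₂; map₁)
open import Data.Vec as Vec using (Vec; []; _∷_)
open import Function using (_∘_; flip)
open import Relation.Binary.Definitions using (tri<; tri≈; tri>)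
open import Relation.Binary.PropositionalEquality
open import Relation.Nullary using (¬_; Dec; yes; no; contradiction; _×-dec_; _⊎-dec_; _→-dec_)
open import Relation.Nullary.Decidable using (True; toWitness)
open +-*-Solver using (solve; _:+_; _:*_; con; _:=_)

-- Read the n vertices and n edges of the cycle as one cyclic sequence of 2n colours.  An arc of
-- length d uses the colours of an interval of 2d-1 elements that begins and ends at an edge.
--
-- Upper bounds: a geodesic uses at most n-1 consecutive elements, so repeating 0,…,n-1 twice always
-- works; the small cases with fewer colours are explicit tables.
--
-- Lower bounds: an (almost) antipodal pair needs 2⌊n/2⌋-1 colours.  With fewer than n colours no
-- rainbow path is longer than n/2, so every interval belonging to an arc shorter than n/2 is rainbow.
-- Then equally coloured elements are far apart, and for n = 11 and n ≥ 13 no colour occurs three times.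

private
  variable
    A : Set
    k : ℕ

-- Lists of consecutive values and lists without repetition.

applyUpTo-cong : {f g : ℕ → A} → (∀ t → f t ≡ g t) → ∀ m → applyUpTo f m ≡ applyUpTo g m
applyUpTo-cong {f = f} {g} f≗g m =
  trans (sym (map-upTo f m)) (trans (map-cong f≗g (upTo m)) (map-upTo g m))

last-applyUpTo : ∀ (x : ℕ → A) m → last (applyUpTo x (suc m)) ≡ just (x m)
last-applyUpTo x zero    = refl
last-applyUpTo x (suc m) = last-applyUpTo (x ∘ suc) m

last-applyDownFrom : ∀ (x : ℕ → A) m → last (applyDownFrom x (suc m)) ≡ just (x 0)
last-applyDownFrom x zero    = refl
last-applyDownFrom x (suc m) = last-applyDownFrom x m

applyDownFrom↭applyUpTo : ∀ (f : ℕ → A) m → applyDownFrom f m ↭ applyUpTo f m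
applyDownFrom↭applyUpTo f m =
  ↭-trans (↭-reflexive (sym (reverse-applyUpTo f m))) (↭-reverse (applyUpTo f m))

-- `TotalRainbow` lists all edge colours before the vertex colours, while along the cycle they
-- alternate. Being rainbow is invariant under permutation, so this passes from one order to the
-- other.
deinterleave : ∀ (h : ℕ → A) d →
  applyUpTo (λ t → h (t * 2)) (suc d) ++ applyUpTo (λ t → h (suc (t * 2))) d
    ↭ applyUpTo h (suc (d * 2))
deinterleave h zero    = ↭-refl
deinterleave h (suc d) = prep _ (↭-trans
  (shift _ (applyUpTo (λ t → h (suc t * 2)) (suc d)) _)
  (prep _ (deinterleave (h ∘ suc ∘ suc) d)))

Unique-resp-↭ : {xs ys : List A} → xs ↭ ys → Unique xs → Unique ys
Unique-resp-↭ {A} p = Permutation.Unique-resp-↭ (setoid A) (↭⇒↭ₛ p)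

Unique-applyUpTo⁻ : ∀ (f : ℕ → A) m → Unique (applyUpTo f m) → ∀ {a b} → a < b → b < m → f a ≢ f b
Unique-applyUpTo⁻ f (suc m) (px ∷ u) {zero}  {suc b} _   b<m = All.applyUpTo⁻ (f ∘ suc) m px (s<s⁻¹ b<m)
Unique-applyUpTo⁻ f (suc m) (px ∷ u) {suc a} {suc b} a<b b<m =
  Unique-applyUpTo⁻ (f ∘ suc) m u (s<s⁻¹ a<b) (s<s⁻¹ b<m)

Unique-lookup : {xs : List A} → Unique xs → ∀ {i j} → i Fin.< j → lookup xs i ≢ lookup xs j
Unique-lookup {xs = x ∷ xs} (px ∷ u) {Fin.zero}  {Fin.suc j} _   = All.lookup px (∈-lookup j)
Unique-lookup {xs = x ∷ xs} (px ∷ u) {Fin.suc i} {Fin.suc j} i<j = Unique-lookup u (s<s⁻¹ i<j)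

Unique⇒length≤ : {xs : List (Fin k)} → Unique xs → length xs ≤ k
Unique⇒length≤ {xs = xs} u = ≮⇒≥ λ k<l →
  let _ , _ , i<j , eq = Fin.pigeonhole k<l (lookup xs) in Unique-lookup u i<j eq

-- Colours and lengths of paths.

edgeCols-applyUpTo : ∀ {n} (ec : Fin n → Fin n → Fin k) x d →
  edgeCols ec (applyUpTo x (suc d)) ≡ applyUpTo (λ t → ec (x t) (x (suc t))) d
edgeCols-applyUpTo ec x zero    = refl
edgeCols-applyUpTo ec x (suc d) = cong (_ ∷_) (edgeCols-applyUpTo ec (x ∘ suc) d)

edgeCols-applyDownFrom : ∀ {n} (ec : Fin n → Fin n → Fin k) x d →
  edgeCols ec (applyDownFrom x (suc d)) ≡ applyDownFrom (λ t → ec (x (suc t)) (x t)) d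
edgeCols-applyDownFrom ec x zero    = refl
edgeCols-applyDownFrom ec x (suc d) = cong (_ ∷_) (edgeCols-applyDownFrom ec x d)

dropLast-applyUpTo : ∀ (x : ℕ → A) d → dropLast (applyUpTo x (suc d)) ≡ applyUpTo x d
dropLast-applyUpTo x zero    = refl
dropLast-applyUpTo x (suc d) = cong (_ ∷_) (dropLast-applyUpTo (x ∘ suc) d)

dropLast-applyDownFrom : ∀ (x : ℕ → A) d →
  dropLast (applyDownFrom x (suc d)) ≡ applyDownFrom (x ∘ suc) d
dropLast-applyDownFrom x zero    = refl
dropLast-applyDownFrom x (suc d) = cong (_ ∷_) (dropLast-applyDownFrom x d)

length-edgeCols : ∀ {n} (ec : Fin n → Fin n → Fin k) ps → length (edgeCols ec ps) ≡ pathLength ps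
length-edgeCols ec []          = refl
length-edgeCols ec (x ∷ [])    = refl
length-edgeCols ec (x ∷ y ∷ r) = cong suc (length-edgeCols ec (y ∷ r))

length-dropLast : ∀ (xs : List A) → length (dropLast xs) ≡ length xs ∸ 1
length-dropLast []          = refl
length-dropLast (x ∷ [])    = refl
length-dropLast (x ∷ y ∷ r) = cong suc (length-dropLast (y ∷ r))

length-internal : ∀ (ps : List A) → length (internal ps) ≡ pathLength ps ∸ 1
length-internal []       = refl
length-internal (x ∷ ps) = length-dropLast ps

-- A path with ℓ ≥ 1 edges has ℓ - 1 internal vertices, and all these colours differ.
rainbow⇒short : ∀ {n} (vc : Fin n → Fin k) ec ps → TotalRainbow vc ec ps →
  pathLength ps + (pathLength ps ∸ 1) ≤ k
rainbow⇒short {k} vc ec ps u = subst (_≤ k) (begin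
  length (edgeCols ec ps ++ map vc (internal ps))          ≡⟨ length-++ (edgeCols ec ps) ⟩
  length (edgeCols ec ps) + length (map vc (internal ps))  ≡⟨ cong₂ _+_ (length-edgeCols ec ps) internal-length ⟩
  pathLength ps + (pathLength ps ∸ 1)                      ∎) (Unique⇒length≤ u)
  where
  open ≡-Reasoning
  internal-length : length (map vc (internal ps)) ≡ pathLength ps ∸ 1
  internal-length = trans (length-map vc (internal ps)) (length-internal ps)

-- Residues modulo n.

%-≡⇒∣∸ : ∀ {n} .{{_ : NonZero n}} a b → a % n ≡ b % n → n ∣ b ∸ a
%-≡⇒∣∸ {n} a b eq = divides (b / n ∸ a / n) (begin
  b ∸ a                                      ≡⟨ cong₂ _∸_ (m≡m%n+[m/n]*n b n) (m≡m%n+[m/n]*n a n) ⟩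
  (b % n + b / n * n) ∸ (a % n + a / n * n)  ≡⟨ cong (λ r → (b % n + b / n * n) ∸ (r + a / n * n)) eq ⟩
  (b % n + b / n * n) ∸ (b % n + a / n * n)  ≡⟨ [m+n]∸[m+o]≡n∸o (b % n) _ _ ⟩
  b / n * n ∸ a / n * n                      ≡⟨ *-distribʳ-∸ n (b / n) (a / n) ⟨
  (b / n ∸ a / n) * n                        ∎)
  where open ≡-Reasoning

∣∧<⇒≡0 : ∀ {n m} → n ∣ m → m < n → m ≡ 0
∣∧<⇒≡0 {m = zero}  _   _   = refl
∣∧<⇒≡0 {m = suc m} n∣m m<n = contradiction (∣⇒≤ n∣m) (<⇒≱ m<n)

suc-% : ∀ i n .{{_ : NonZero n}} → suc (i % n) % n ≡ suc i % n
suc-% i n = trans (sym ([m+kn]%n≡m%n (suc (i % n)) (i / n) n)) (cong (λ j → suc j % n) (sym (m≡m%n+[m/n]*n i n)))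

-- Paths on the cycle are arcs.

Succ-functional : ∀ {n} {u v w : Fin n} → Succ n u v → Succ n u w → v ≡ w
Succ-functional         (inj₁ p)       (inj₁ q)       = Fin.toℕ-injective (trans (sym p) q)
Succ-functional {v = v} (inj₁ p)       (inj₂ (q , _)) = contradiction (trans (sym p) q) (<⇒≢ (Fin.toℕ<n v))
Succ-functional {w = w} (inj₂ (p , _)) (inj₁ q)       = contradiction (trans (sym q) p) (<⇒≢ (Fin.toℕ<n w))
Succ-functional         (inj₂ (_ , p)) (inj₂ (_ , q)) = Fin.toℕ-injective (trans p (sym q))

Succ-injective : ∀ {n} {u v w : Fin n} → Succ n u w → Succ n v w → u ≡ v
Succ-injective (inj₁ p)       (inj₁ q)       = Fin.toℕ-injective (suc-injective (trans p (sym q)))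
Succ-injective (inj₁ p)       (inj₂ (_ , q)) = contradiction (trans p q) λ()
Succ-injective (inj₂ (_ , p)) (inj₁ q)       = contradiction (trans q p) λ()
Succ-injective (inj₂ (p , _)) (inj₂ (q , _)) = Fin.toℕ-injective (suc-injective (trans p (sym q)))

-- A path cannot turn back, since the vertex it would return to is already used.
path-monotone : ∀ {n} {ps : List (Fin n)} → Linked (Cycle n) ps → Unique ps →
  Linked (Succ n) ps ⊎ Linked (flip (Succ n)) ps
path-monotone []               _ = inj₁ []
path-monotone [-]              _ = inj₁ [-]
path-monotone (inj₁ s ∷ [-])   _ = inj₁ (s ∷ [-])
path-monotone (inj₂ s ∷ [-])   _ = inj₂ (s ∷ [-])
path-monotone (c ∷ cs@(_ ∷ _)) ((_ ∷ x≢z ∷ _) ∷ u) with c | path-monotone cs u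
... | inj₁ s | inj₁ ss       = inj₁ (s ∷ ss)
... | inj₂ s | inj₂ ss       = inj₂ (s ∷ ss)
... | inj₁ s | inj₂ (s′ ∷ _) = contradiction (Succ-injective s s′) x≢z
... | inj₂ s | inj₁ (s′ ∷ _) = contradiction (Succ-functional s s′) x≢z

-- The colours on an arc with d+1 (not d) edges starting at the vertex i.
window : (ℕ → Fin k) → ℕ → ℕ → List (Fin k)
window C i d = applyUpTo (λ p → C (p + i * 2)) (suc (d * 2))

module _ {n : ℕ} .{{_ : NonZero n}} where

  toℕ-mod : ∀ i → toℕ (i mod n) ≡ i % n
  toℕ-mod i = Fin.toℕ-fromℕ< (m%n<n i n)

  mod-cong : ∀ {i j} → i % n ≡ j % n → i mod n ≡ j mod n
  mod-cong {i} {j} eq = Fin.toℕ-injective (trans (toℕ-mod i) (trans eq (sym (toℕ-mod j))))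

  toℕ-mod-inverse : ∀ (u : Fin n) → toℕ u mod n ≡ u
  toℕ-mod-inverse u = Fin.toℕ-injective (trans (toℕ-mod (toℕ u)) (m<n⇒m%n≡m (Fin.toℕ<n u)))

  mod-injective : ∀ i {a b} → a < n → b < n → (a + i) mod n ≡ (b + i) mod n → a ≡ b
  -- Truncated subtraction yields only one inequality per divisibility, so `below` is applied in
  -- both directions.
  mod-injective i {a} {b} a<n b<n eq = ≤-antisym (below a<n (sym eq%)) (below b<n eq%)
    where
    eq% : (a + i) % n ≡ (b + i) % n
    eq% = trans (sym (toℕ-mod (a + i))) (trans (cong toℕ eq) (toℕ-mod (b + i)))
    below : ∀ {a b} → b < n → (a + i) % n ≡ (b + i) % n → b ≤ a
    below {a} {b} b<n eq = m∸n≡0⇒m≤n (∣∧<⇒≡0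
      (subst (n ∣_) (trans (cong₂ _∸_ (+-comm b i) (+-comm a i)) ([m+n]∸[m+o]≡n∸o i b a)) (%-≡⇒∣∸ (a + i) (b + i) eq))
      (≤-<-trans (m∸n≤m b a) b<n))

  Succ-mod : ∀ i → Succ n (i mod n) (suc i mod n)
  Succ-mod i with m≤n⇒m<n∨m≡n (m%n<n i n)
  ... | inj₁ <n = inj₁ (begin
    suc (toℕ (i mod n))  ≡⟨ cong suc (toℕ-mod i) ⟩
    suc (i % n)          ≡⟨ m<n⇒m%n≡m <n ⟨
    suc (i % n) % n      ≡⟨ suc-% i n ⟩
    suc i % n            ≡⟨ toℕ-mod (suc i) ⟨
    toℕ (suc i mod n)    ∎) where open ≡-Reasoning
  ... | inj₂ ≡n = inj₂ (trans (cong suc (toℕ-mod i)) ≡n , (begin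
    toℕ (suc i mod n)  ≡⟨ toℕ-mod (suc i) ⟩
    suc i % n          ≡⟨ suc-% i n ⟨
    suc (i % n) % n    ≡⟨ cong (_% n) ≡n ⟩
    n % n              ≡⟨ n%n≡0 n ⟩
    0                  ∎)) where open ≡-Reasoning

  linked-up : ∀ (i : ℕ) {u us} → u ≡ i mod n → Linked (Succ n) (u ∷ us) →
    u ∷ us ≡ applyUpTo (λ t → (t + i) mod n) (suc (length us))
  linked-up i refl [-]      = refl
  linked-up i {us = w ∷ us} refl (s ∷ ss) = cong ((i mod n) ∷_)
    (trans (linked-up (suc i) (Succ-functional s (Succ-mod i)) ss)
      (applyUpTo-cong (λ t → cong (_mod n) (+-suc t i)) (suc (length us))))

  -- Counting back from the last vertex `j`, each step up the list adds one. Only the first vertex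
  -- is recorded, which fixes the length modulo n.
  linked-down : ∀ (j : ℕ) {u us} → last (u ∷ us) ≡ just (j mod n) → Linked (flip (Succ n)) (u ∷ us) →
    u ≡ (length us + j) mod n
  linked-down j eq [-] = just-injective eq
  linked-down j {us = w ∷ us} eq (s ∷ ss) = Succ-functional
    (subst (λ v → Succ n v _) (linked-down j eq ss) s) (Succ-mod (length us + j))

  Arc : ℕ → ℕ → List (Fin n)
  Arc i d = applyUpTo (λ t → (t + i) mod n) (suc d)

  path-is-arc : ∀ i j {ps} → IsPath (Cycle n) (i mod n) (j mod n) ps →
    (ps ≡ Arc i (pathLength ps) × (pathLength ps + i) mod n ≡ j mod n)
      ⊎ (pathLength ps + j) mod n ≡ i mod n
  path-is-arc i j {u ∷ us} (l , un , h , e) with path-monotone l un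
  ... | inj₂ ss = inj₂ (trans (sym (linked-down j e ss)) (just-injective h))
  ... | inj₁ ss with p ← linked-up i (just-injective h) ss =
    inj₁ (p , just-injective (trans (sym (last-applyUpTo (λ t → (t + i) mod n) (length us))) (trans (cong last (sym p)) e)))

  -- The two congruences say ℓ ≡ d and ℓ ≡ -d modulo n, one for each way round. If ℓ < d, then ℓ, d
  -- and ℓ + d all lie below n, and neither congruence can hold.
  distance : ∀ i d ℓ → d + d ≤ n → (ℓ + i) mod n ≡ (d + i) mod n ⊎ (ℓ + (d + i)) mod n ≡ i mod n → d ≤ ℓ
  distance i d ℓ 2d≤n (inj₁ eq) = ≮⇒≥ λ ℓ<d →
    let d<n = <-≤-trans (m<m+n d (≤-<-trans z≤n ℓ<d)) 2d≤n
    in <⇒≢ ℓ<d (mod-injective i (<-trans ℓ<d d<n) d<n eq)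
  distance i d ℓ 2d≤n (inj₂ eq) = ≮⇒≥ λ ℓ<d →
    let ℓ+d<n = <-≤-trans (+-monoˡ-< d ℓ<d) 2d≤n
        ℓ+d≡0 = mod-injective i ℓ+d<n (≤-<-trans z≤n ℓ+d<n) (trans (cong (_mod n) (+-assoc ℓ d i)) eq)
    in n≮0 (subst (ℓ <_) (m+n≡0⇒n≡0 ℓ ℓ+d≡0) ℓ<d)

  -- Colours along arcs.

  -- The 2n coloured elements in cyclic order: position 2t is the edge {t, t+1} and position 2t+1
  -- is the vertex t+1, so that the elements of an arc form an interval starting at an even position.
  Reads : (ℕ → Fin k) → (Fin n → Fin k) → (Fin n → Fin n → Fin k) → Set
  Reads C vc ec = (∀ t → ec (t mod n) (suc t mod n) ≡ C (t * 2)) × (∀ t → vc (suc t mod n) ≡ C (suc (t * 2)))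

  module _ (C : ℕ → Fin k) {vc ec} (reads : Reads C vc ec) (i d : ℕ) where

    private
      x : ℕ → Fin n
      x t = (t + i) mod n

      edge : ∀ t → ec (x t) (x (suc t)) ≡ C (t * 2 + i * 2)
      edge t = trans (proj₁ reads (t + i)) (cong C (*-distribʳ-+ 2 t i))

      vertex : ∀ t → vc (x (suc t)) ≡ C (suc (t * 2 + i * 2))
      vertex t = trans (proj₂ reads (t + i)) (cong (C ∘ suc) (*-distribʳ-+ 2 t i))

    arc-colours : edgeCols ec (Arc i (suc d)) ++ map vc (internal (Arc i (suc d))) ↭ window C i d
    arc-colours = ↭-trans (↭-reflexive (cong₂ _++_
      (trans (edgeCols-applyUpTo ec x (suc d)) (applyUpTo-cong edge (suc d)))
      (trans (cong (map vc) (dropLast-applyUpTo (x ∘ suc) d))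
        (trans (map-applyUpTo (x ∘ suc) vc d) (applyUpTo-cong vertex d)))))
      (deinterleave (λ p → C (p + i * 2)) d)

    reversed-arc-colours : (∀ u v → ec u v ≡ ec v u) → let ps = applyDownFrom x (suc (suc d)) in
      edgeCols ec ps ++ map vc (internal ps) ↭ window C i d
    reversed-arc-colours ec-sym = ↭-trans (++⁺
      (↭-trans (↭-reflexive (edgeCols-applyDownFrom ec x (suc d)))
        (↭-trans (applyDownFrom↭applyUpTo (λ t → ec (x (suc t)) (x t)) (suc d))
          (↭-reflexive (applyUpTo-cong (λ t → trans (ec-sym _ _) (edge t)) (suc d)))))
      (↭-trans (↭-reflexive (trans (cong (map vc) (dropLast-applyDownFrom x d)) (map-applyDownFrom (x ∘ suc) vc d)))
        (↭-trans (applyDownFrom↭applyUpTo (vc ∘ x ∘ suc) d) (↭-reflexive (applyUpTo-cong vertex d)))))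
      (deinterleave (λ p → C (p + i * 2)) d)

-- Lower bounds for general n.

ℓ+ℓ≤1+ℓ+[ℓ∸1] : ∀ ℓ → ℓ + ℓ ≤ suc (ℓ + (ℓ ∸ 1))
ℓ+ℓ≤1+ℓ+[ℓ∸1] zero    = z≤n
ℓ+ℓ≤1+ℓ+[ℓ∸1] (suc m) = ≤-reflexive (cong suc (+-suc m m))

m+m≤o∧n+n<o⇒m+n<o : ∀ m n {o} → m + m ≤ o → n + n < o → m + n < o
m+m≤o∧n+n<o⇒m+n<o m n {o} p q = ≰⇒> λ o≤ → <⇒≱ (+-mono-≤-< p q)
  (subst (o + o ≤_) (interchange m n m n) (+-mono-≤ o≤ o≤))
  where open import Algebra.Properties.CommutativeSemigroup +-commutativeSemigroup using (interchange)

interleave : (ℕ → A) → (ℕ → A) → ℕ → A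
interleave f g zero    = f 0
interleave f g (suc p) = interleave g (f ∘ suc) p

interleave-even : ∀ (f g : ℕ → A) t → interleave f g (t * 2) ≡ f t
interleave-even f g zero    = refl
interleave-even f g (suc t) = interleave-even (f ∘ suc) (g ∘ suc) t

interleave-odd : ∀ (f g : ℕ → A) t → interleave f g (suc (t * 2)) ≡ g t
interleave-odd f g = interleave-even g (f ∘ suc)

halve : ∀ p → ∃ λ t → p ≡ t * 2 ⊎ p ≡ suc (t * 2)
halve zero          = 0 , inj₁ refl
halve (suc zero)    = 0 , inj₂ refl
halve (suc (suc p)) with halve p
... | t , inj₁ refl = suc t , inj₁ refl
... | t , inj₂ refl = suc t , inj₂ refl

-- Pair each value with the bit telling whether it was taken before, and apply the pigeonhole principle.
pigeonhole₃ : ∀ {m} → k * 2 < m → (f : Fin m → Fin k) →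
  ∃ λ a → ∃ λ b → ∃ λ c → a Fin.< b × b Fin.< c × f a ≡ f b × f b ≡ f c
pigeonhole₃ {k} {m} 2k<m f =
  let b , c , b<c , eq = Fin.pigeonhole 2k<m g
      fb≡fc , same-bit = Fin.combine-injective (f b) (bit (repeat? b)) (f c) (bit (repeat? c)) eq
      -- The element `b` makes `c` a repetition; the bits agree, so `b` is a repetition as well, of
      -- some earlier `a`.
      a , a<b , fa≡fb  = bit-transfer (repeat? c) (repeat? b) (sym same-bit) (b , b<c , fb≡fc)
  in a , b , c , a<b , b<c , fa≡fb , fb≡fc
  where
  repeat? : ∀ i → Dec (∃ λ j → j Fin.< i × f j ≡ f i)
  repeat? i = Fin.any? λ j → (j Fin.<? i) ×-dec (f j Fin.≟ f i)
  bit : {P : Set} → Dec P → Fin 2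
  bit (yes _) = Fin.zero
  bit (no _)  = Fin.suc Fin.zero
  bit-transfer : {P Q : Set} (p? : Dec P) (q? : Dec Q) → bit p? ≡ bit q? → P → Q
  bit-transfer _        (yes q) _  _ = q
  bit-transfer (yes _)  (no _)  () _
  bit-transfer (no ¬p)  (no _)  _  p = contradiction p ¬p
  g : Fin m → Fin (k * 2)
  g i = Fin.combine (f i) (bit (repeat? i))

module LowerBounds {n k : ℕ} .{{_ : NonZero n}} (trc : TRConnectedWith n (Cycle n) k) where

  private
    vc = proj₁ trc
    ec = proj₁ (proj₂ trc)
    connected = proj₂ (proj₂ (proj₂ trc))

    arc-end≢ : ∀ i {d} → suc d < n → i mod n ≢ (suc d + i) mod n
    arc-end≢ i d<n eq = contradiction (mod-injective i (≤-<-trans z≤n d<n) d<n eq) λ()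

    edge vertex : ℕ → Fin k
    edge   t = ec (t mod n) (suc t mod n)
    vertex t = vc (suc t mod n)

  colour : ℕ → Fin k
  colour = interleave edge vertex

  colour-reads : Reads colour vc ec
  colour-reads = (λ t → sym (interleave-even edge vertex t)) , (λ t → sym (interleave-odd edge vertex t))

  -- Any path joining vertices at distance d + 1 has at least d + 1 edges and d internal vertices,
  -- whichever way round it goes.
  diameter-bound : ∀ d → suc d + suc d ≤ n → suc d + d ≤ k
  diameter-bound d 2d≤n with ps , path , rb ← connected (0 mod n) ((suc d + 0) mod n)
                                (arc-end≢ 0 (<-≤-trans (m<m+n (suc d) z<s) 2d≤n)) =
    ≤-trans (+-mono-≤ d≤ℓ (pred-mono-≤ d≤ℓ)) (rainbow⇒short vc ec ps rb)
    where
    d≤ℓ : suc d ≤ pathLength ps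
    d≤ℓ = distance 0 (suc d) (pathLength ps) 2d≤n (map₁ proj₂ (path-is-arc 0 (suc d + 0) path))

  -- With fewer than n colours no rainbow path is longer than n/2, so a pair at distance d < n/2
  -- must be joined by its short arc.
  window-rainbow : k < n → ∀ {d} → suc d + suc d < n → ∀ i → Unique (window colour i d)
  window-rainbow k<n {d} 2d<n i
    with ps , path , rb ← connected (i mod n) ((suc d + i) mod n) (arc-end≢ i (<-trans (m<m+n (suc d) z<s) 2d<n))
    with path-is-arc i (suc d + i) path
  ... | inj₁ (ps≡arc , eq) = Unique-resp-↭ (arc-colours colour colour-reads i d)
    (subst (TotalRainbow vc ec) (trans ps≡arc (cong (Arc i) ℓ≡d)) rb)
    where
    ℓ<n : pathLength ps < n
    ℓ<n = ≤-<-trans (≤-trans (m≤m+n _ _) (rainbow⇒short vc ec ps rb)) k<n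
    ℓ≡d : pathLength ps ≡ suc d
    ℓ≡d = mod-injective i ℓ<n (<-trans (m<m+n (suc d) z<s) 2d<n) eq
  ... | inj₂ eq = contradiction ℓ+d≡0 (m+1+n≢0 (pathLength ps))
    where
    -- The other way round would need ℓ + (d + 1) to be a multiple of n. But 2ℓ ≤ k + 1 ≤ n and 2(d
    -- + 1) < n, so this positive sum stays below n.
    ℓ+d<n : pathLength ps + suc d < n
    ℓ+d<n = m+m≤o∧n+n<o⇒m+n<o (pathLength ps) (suc d)
      (≤-trans (ℓ+ℓ≤1+ℓ+[ℓ∸1] (pathLength ps)) (≤-<-trans (rainbow⇒short vc ec ps rb) k<n)) 2d<n
    ℓ+d≡0 : pathLength ps + suc d ≡ 0
    ℓ+d≡0 = mod-injective i ℓ+d<n (≤-<-trans z≤n ℓ+d<n)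
      (trans (cong (_mod n) (+-assoc (pathLength ps) (suc d) i)) eq)

  colour-periodic : ∀ p → colour (p + n * 2) ≡ colour p
  colour-periodic p with halve p
  ... | t , inj₁ refl = begin
    colour (t * 2 + n * 2)  ≡⟨ cong colour (*-distribʳ-+ 2 t n) ⟨
    colour ((t + n) * 2)    ≡⟨ interleave-even edge vertex (t + n) ⟩
    edge (t + n)            ≡⟨ cong₂ ec (mod-cong ([m+n]%n≡m%n t n)) (mod-cong ([m+n]%n≡m%n (suc t) n)) ⟩
    edge t                  ≡⟨ interleave-even edge vertex t ⟨
    colour (t * 2)          ∎ where open ≡-Reasoning
  ... | t , inj₂ refl = begin
    colour (suc (t * 2 + n * 2))  ≡⟨ cong (colour ∘ suc) (*-distribʳ-+ 2 t n) ⟨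
    colour (suc ((t + n) * 2))    ≡⟨ interleave-odd edge vertex (t + n) ⟩
    vertex (t + n)                ≡⟨ cong vc (mod-cong ([m+n]%n≡m%n (suc t) n)) ⟩
    vertex t                      ≡⟨ interleave-odd edge vertex t ⟨
    colour (suc (t * 2))          ∎ where open ≡-Reasoning

  module FewColours (k<n : k < n) (d : ℕ) (2d<n : suc d + suc d < n) where

    distinct : ∀ i a b → a < b → b ≤ d * 2 → colour (a + i * 2) ≢ colour (b + i * 2)
    distinct i a b a<b b≤2d =
      Unique-applyUpTo⁻ (λ p → colour (p + i * 2)) (suc (d * 2)) (window-rainbow k<n 2d<n i) a<b (s≤s b≤2d)

    -- A closer pair would lie in one rainbow window. Windows start only at edges, so for a vertex
    -- position the window begins one place earlier; this is why the gap is 2d and not 2d + 1.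
    separated : ∀ {p q} → p < q → colour p ≡ colour q → p + d * 2 ≤ q
    separated {p} {q} p<q eq with b , refl ← m≤n⇒∃[o]m+o≡n (<⇒≤ p<q) = ≮⇒≥ λ b<2d →
      conflict (halve p) (0<b p<q) (+-cancelˡ-< p b (d * 2) b<2d) eq
      where
      0<b : ∀ {b} → p < p + b → 0 < b
      0<b {b} lt = +-cancelˡ-< p 0 b (subst (_< p + b) (sym (+-identityʳ p)) lt)
      conflict : ∀ {p b} → (∃ λ t → p ≡ t * 2 ⊎ p ≡ suc (t * 2)) → 0 < b → b < d * 2 → colour p ≢ colour (p + b)
      conflict {b = b} (t , inj₁ refl) 0<b b<2d eq =
        distinct t 0 b 0<b (<⇒≤ b<2d) (trans eq (cong colour (+-comm (t * 2) b)))
      conflict {b = b} (t , inj₂ refl) 0<b b<2d eq =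
        distinct t 1 (suc b) (s<s 0<b) b<2d (trans eq (cong (colour ∘ suc) (+-comm (t * 2) b)))

    -- The 2d + 1 colours of a window are distinct and number at least k. Putting `c` in front of
    -- them forces a coincidence, which must involve `c`.
    every-colour-in-window : k ≤ suc (d * 2) → ∀ c i → ∃ λ a → a ≤ d * 2 × colour (a + i * 2) ≡ c
    every-colour-in-window k≤ c i = found (Fin.pigeonhole (s≤s k≤) f)
      where
      f : Fin (suc (suc (d * 2))) → Fin k
      f Fin.zero    = c
      f (Fin.suc a) = colour (toℕ a + i * 2)
      found : (∃₂ λ a b → a Fin.< b × f a ≡ f b) → ∃ λ a → a ≤ d * 2 × colour (a + i * 2) ≡ c
      found (Fin.zero  , Fin.suc b , _   , eq) = toℕ b , s≤s⁻¹ (Fin.toℕ<n b) , sym eq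
      found (Fin.suc a , Fin.suc b , a<b , eq) =
        contradiction eq (distinct i (toℕ a) (toℕ b) (s<s⁻¹ a<b) (s≤s⁻¹ (Fin.toℕ<n b)))

  -- Two elements of one colour are at least 2d apart, so a third one would make the whole cycle
  -- of 2n elements at least 6d long.
  sparse-bound : ∀ d → suc d + suc d < n → n < 3 * d → n ≤ k
  sparse-bound d 2d<n n<3d = ≮⇒≥ λ k<n →
    let a , b , c , a<b , b<c , fa≡fb , fb≡fc = pigeonhole₃ (*-monoˡ-< 2 k<n) (colour ∘ toℕ)
    in <⇒≱ n<3d (*-cancelʳ-≤ (3 * d) n 2 (+-cancelˡ-≤ (toℕ a) _ _
         (once-round k<n a<b b<c (Fin.toℕ<n c) fa≡fb fb≡fc)))
    where
    open ≤-Reasoning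
    once-round : k < n → ∀ {a b c} → a < b → b < c → c < n * 2 → colour a ≡ colour b → colour b ≡ colour c →
      a + 3 * d * 2 ≤ a + n * 2
    once-round k<n {a} {b} {c} a<b b<c c<2n eq eq′ = begin
      -- The three gaps run from `a` to `b`, from `b` to `c`, and from `c` to the copy of `a` one
      -- round later.
      a + 3 * d * 2              ≡⟨ solve 2 (λ a d → a :+ con 3 :* d :* con 2
                                      := a :+ d :* con 2 :+ d :* con 2 :+ d :* con 2) refl a d ⟩
      a + d * 2 + d * 2 + d * 2  ≤⟨ +-monoˡ-≤ (d * 2) (+-monoˡ-≤ (d * 2) (separated a<b eq)) ⟩
      b + d * 2 + d * 2          ≤⟨ +-monoˡ-≤ (d * 2) (separated b<c eq′) ⟩
      c + d * 2                  ≤⟨ separated (<-≤-trans c<2n (m≤n+m (n * 2) a))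
                                      (trans (sym (trans eq eq′)) (sym (colour-periodic a))) ⟩
      a + n * 2                  ∎
      where open FewColours k<n d 2d<n

-- Lower bounds for the cycles of order 7 and 9.

offset : ∀ {m n} → m ≤ n → ∃ λ o → o + m ≡ n
offset {m} {n} m≤n = n ∸ m , m∸n+n≡m m≤n

-- Two edges of one colour are at distance 3, and then the window avoiding both lacks that colour.
trc-C₇ : TRConnectedWith 7 (Cycle 7) k → 6 ≤ k
trc-C₇ {k} trc = ≰⇒> λ k≤5 →
  let a , b , a<b , eq = Fin.pigeonhole (s≤s (m≤n⇒m≤1+n k≤5)) (λ j → colour (toℕ {7} j * 2))
  in no-repetition k≤5 (offset a<b) (Fin.toℕ<n b) eq
  where
  open LowerBounds {7} trc
  wrap : ∀ p → colour (14 + p) ≡ colour p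
  wrap p = trans (cong colour (+-comm 14 p)) (colour-periodic p)
  module _ (k≤5 : k ≤ 5) where
    open FewColours (s≤s (m≤n⇒m≤1+n k≤5)) 2 ≤-refl
    distance1 : ∀ x → colour (x * 2) ≢ colour ((1 + x) * 2)
    distance1 x = distinct x 0 2 (m<m+n 0 z<s) (m≤m+n 2 2)
    distance2 : ∀ x → colour (x * 2) ≢ colour ((2 + x) * 2)
    distance2 x = distinct x 0 4 (m<m+n 0 z<s) ≤-refl
    distance3 : ∀ x → colour (x * 2) ≢ colour ((3 + x) * 2)
    distance3 x eq with every-colour-in-window k≤5 (colour (x * 2)) (4 + x)
    -- The first three positions of the window are too close to the edge `3 + x`; the last two are
    -- too close to the edge `7 + x`, which is the edge `x` one round later.
    ... | 0 , _ , eq′ = distinct (3 + x) 0 2 (m<m+n 0 z<s) (m≤m+n 2 2) (sym (trans eq′ eq))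
    ... | 1 , _ , eq′ = distinct (3 + x) 0 3 (m<m+n 0 z<s) (m≤m+n 3 1) (sym (trans eq′ eq))
    ... | 2 , _ , eq′ = distinct (3 + x) 0 4 (m<m+n 0 z<s) ≤-refl (sym (trans eq′ eq))
    ... | 3 , _ , eq′ = distinct (5 + x) 1 4 (m<m+n 1 z<s) ≤-refl (trans eq′ (sym (wrap (x * 2))))
    ... | 4 , _ , eq′ = distinct (5 + x) 2 4 (m<m+n 2 z<s) ≤-refl (trans eq′ (sym (wrap (x * 2))))
    ... | suc (suc (suc (suc (suc a)))) , a≤4 , _ = contradiction a≤4 (<⇒≱ (m≤m+n 5 a))
    no-repetition : ∀ {a b} → (∃ λ o → o + suc a ≡ b) → b < 7 → colour (a * 2) ≢ colour (b * 2)
    no-repetition {a} (0 , refl) _ eq = distance1 a eq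
    no-repetition {a} (1 , refl) _ eq = distance2 a eq
    no-repetition {a} (2 , refl) _ eq = distance3 a eq
    -- Gaps 4, 5 and 6 become 3, 2 and 1 when measured onward from `b` to `a` in the next round.
    no-repetition {a} (3 , refl) _ eq = distance3 (4 + a) (trans (sym eq) (sym (wrap (a * 2))))
    no-repetition {a} (4 , refl) _ eq = distance2 (5 + a) (trans (sym eq) (sym (wrap (a * 2))))
    no-repetition {a} (5 , refl) _ eq = distance1 (6 + a) (trans (sym eq) (sym (wrap (a * 2))))
    no-repetition {a} (suc (suc (suc (suc (suc (suc o))))) , refl) b<7 _ =
      contradiction b<7 (≤⇒≯ (+-monoʳ-≤ 6 (m≤n⇒m≤o+n o z<s)))

-- The colour of the edge {0,1} must occur in the windows from 1 and from 5, hence at positions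
-- 7 or 8 and at 10 or 11; but these all lie in the window from 3.
trc-C₉ : TRConnectedWith 9 (Cycle 9) k → 8 ≤ k
trc-C₉ {k} trc = ≰⇒> λ k≤7 → clash k≤7 (before k≤7) (after k≤7)
  where
  open LowerBounds {9} trc
  module _ (k≤7 : k ≤ 7) where
    open FewColours (s≤s (m≤n⇒m≤1+n k≤7)) 3 ≤-refl
    before : colour 7 ≡ colour 0 ⊎ colour 8 ≡ colour 0
    before with every-colour-in-window k≤7 (colour 0) 1
    ... | 5 , _ , eq = inj₁ eq
    ... | 6 , _ , eq = inj₂ eq
    ... | suc (suc (suc (suc (suc (suc (suc a)))))) , a≤6 , _ = contradiction a≤6 (<⇒≱ (m≤m+n 7 a))
    ... | 0 , _ , eq = contradiction (sym eq) (distinct 0 0 2 (m<m+n 0 z<s) (m≤m+n 2 4))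
    ... | 1 , _ , eq = contradiction (sym eq) (distinct 0 0 3 (m<m+n 0 z<s) (m≤m+n 3 3))
    ... | 2 , _ , eq = contradiction (sym eq) (distinct 0 0 4 (m<m+n 0 z<s) (m≤m+n 4 2))
    ... | 3 , _ , eq = contradiction (sym eq) (distinct 0 0 5 (m<m+n 0 z<s) (m≤m+n 5 1))
    ... | 4 , _ , eq = contradiction (sym eq) (distinct 0 0 6 (m<m+n 0 z<s) ≤-refl)
    after : colour 10 ≡ colour 0 ⊎ colour 11 ≡ colour 0
    after with every-colour-in-window k≤7 (colour 0) 5
    ... | 0 , _ , eq = inj₁ eq
    ... | 1 , _ , eq = inj₂ eq
    -- Positions 12 to 16 share the window from 6 with position 18, which is position 0 one round
    -- later.
    ... | suc (suc a) , a≤6 , eq = contradiction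
      (trans (cong colour (trans (+-suc a 11) (cong suc (+-suc a 10)))) (trans eq (sym (colour-periodic 0))))
      (distinct 6 a 6 (<-≤-trans (n<1+n a) (≤-trans (n≤1+n _) a≤6)) ≤-refl)
    clash : colour 7 ≡ colour 0 ⊎ colour 8 ≡ colour 0 → ¬ (colour 10 ≡ colour 0 ⊎ colour 11 ≡ colour 0)
    clash (inj₁ p) (inj₁ q) = distinct 3 1 4 (m<m+n 1 z<s) (m≤m+n 4 2) (trans p (sym q))
    clash (inj₁ p) (inj₂ q) = distinct 3 1 5 (m<m+n 1 z<s) (m≤m+n 5 1) (trans p (sym q))
    clash (inj₂ p) (inj₁ q) = distinct 3 2 4 (m<m+n 2 z<s) (m≤m+n 4 2) (trans p (sym q))
    clash (inj₂ p) (inj₂ q) = distinct 3 2 5 (m<m+n 2 z<s) (m≤m+n 5 1) (trans p (sym q))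

-- Upper bounds: colourings from sequences of period 2n.

-- A pair at distance n/2 may use either of its two arcs.
Balanced : ℕ → (ℕ → Fin k) → Set
Balanced n C = ∀ {i} → i < n → ∀ {d} → d < n → suc d + suc d ≤ n →
  Unique (window C i d) ⊎ (suc d + suc d ≡ n × Unique (window C (suc d + i) d))

-- Both `i` and `d` range below `n`, so finitely many checks decide the condition; the tables below
-- are verified by evaluating it.
balanced? : ∀ n (C : ℕ → Fin k) → Dec (Balanced n C)
balanced? n C = allUpTo? (λ i → allUpTo? (λ d → (suc d + suc d ≤? n) →-dec
  (unique? (window C i d) ⊎-dec ((suc d + suc d ≟ n) ×-dec unique? (window C (suc d + i) d)))) n) n
  where open import Data.List.Relation.Unary.Unique.DecPropositional Fin._≟_ using (unique?)

%-remove-% : ∀ a b n .{{_ : NonZero n}} → (a % n + b) % n ≡ (a + b) % n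
%-remove-% a b n = begin
  (a % n + b) % n          ≡⟨ %-distribˡ-+ (a % n) b n ⟩
  (a % n % n + b % n) % n  ≡⟨ cong (λ r → (r + b % n) % n) (m%n%n≡m%n a n) ⟩
  (a % n + b % n) % n      ≡⟨ %-distribˡ-+ a b n ⟨
  (a + b) % n              ∎
  where open ≡-Reasoning

-- Edge `t` sits at position 2t, so a shift of the index by n is one period 2n of positions. Applied
-- to `C ∘ suc` it covers the vertices.
periodic-% : ∀ {n} .{{_ : NonZero n}} (C : ℕ → A) → (∀ p → C (p + n * 2) ≡ C p) →
  ∀ {s t} → s % n ≡ t % n → C (s * 2) ≡ C (t * 2)
periodic-% {n = n} C periodic {s} {t} eq =
  trans (reduce s) (trans (cong (λ r → C (r * 2)) eq) (sym (reduce t)))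
  where
  open ≡-Reasoning
  shifted : ∀ m p → C (p + m * (n * 2)) ≡ C p
  shifted zero    p = cong C (+-identityʳ p)
  shifted (suc m) p = trans (cong C (sym (+-assoc p (n * 2) (m * (n * 2))))) (trans (shifted m (p + n * 2)) (periodic p))
  reduce : ∀ t → C (t * 2) ≡ C (t % n * 2)
  reduce t = begin
    C (t * 2)                          ≡⟨ cong (λ t → C (t * 2)) (m≡m%n+[m/n]*n t n) ⟩
    C ((t % n + t / n * n) * 2)        ≡⟨ cong C (*-distribʳ-+ 2 (t % n) (t / n * n)) ⟩
    C (t % n * 2 + t / n * n * 2)      ≡⟨ cong (λ e → C (t % n * 2 + e)) (*-assoc (t / n) n 2) ⟩
    C (t % n * 2 + t / n * (n * 2))    ≡⟨ shifted (t / n) (t % n * 2) ⟩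
    C (t % n * 2)                      ∎

module Construction {n k : ℕ} .{{_ : NonZero n}} (3≤n : 3 ≤ n) (C : ℕ → Fin k)
  (periodic : ∀ p → C (p + n * 2) ≡ C p) where

  -- The vertex t+1 sits at position 2t+1, so u is read at t = u + (n-1) ≡ u - 1.
  vc : Fin n → Fin k
  vc u = C (suc ((toℕ u + (n ∸ 1)) * 2))

  -- An edge a < b is either {a, a+1} or the closing edge {0, n-1}, whose number is b.
  edge : ℕ → ℕ → Fin k
  edge a b with suc a ≟ b
  ... | yes _ = C (a * 2)
  ... | no _  = C (b * 2)

  ec : Fin n → Fin n → Fin k
  ec u v = edge (toℕ u ⊓ toℕ v) (toℕ u ⊔ toℕ v)

  ec-sym : ∀ u v → ec u v ≡ ec v u
  ec-sym u v = cong₂ edge (⊓-comm (toℕ u) (toℕ v)) (⊔-comm (toℕ u) (toℕ v))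

  ec-Succ : ∀ u v → Succ n u v → ec u v ≡ C (toℕ u * 2)
  ec-Succ u v (inj₁ u+1≡v) = trans (cong₂ edge (m≤n⇒m⊓n≡m u≤v) (m≤n⇒m⊔n≡n u≤v)) consecutive
    where
    u≤v : toℕ u ≤ toℕ v
    u≤v = ≤-trans (n≤1+n _) (≤-reflexive u+1≡v)
    consecutive : edge (toℕ u) (toℕ v) ≡ C (toℕ u * 2)
    consecutive with suc (toℕ u) ≟ toℕ v
    ... | yes _ = refl
    ... | no ¬p = contradiction u+1≡v ¬p
  ec-Succ u v (inj₂ (u+1≡n , v≡0)) rewrite v≡0 | ⊓-zeroʳ (toℕ u) | ⊔-identityʳ (toℕ u) = closing
    where
    closing : edge 0 (toℕ u) ≡ C (toℕ u * 2)
    closing with 1 ≟ toℕ u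
    -- Here n would be 2: order at least 3 keeps the closing edge apart from the edge {0, 1}.
    ... | yes 1≡u = contradiction (subst (3 ≤_) (trans (sym u+1≡n) (cong suc (sym 1≡u))) 3≤n) λ { (s≤s (s≤s ())) }
    ... | no _    = refl

  reads : Reads C vc ec
  reads = edges , vertices
    where
    edges : ∀ t → ec (t mod n) (suc t mod n) ≡ C (t * 2)
    edges t = trans (ec-Succ _ _ (Succ-mod t))
      (periodic-% C periodic (trans (cong (_% n) (toℕ-mod t)) (m%n%n≡m%n t n)))
    vertices : ∀ t → vc (suc t mod n) ≡ C (suc (t * 2))
    vertices t = periodic-% (C ∘ suc) (periodic ∘ suc) (begin
      (toℕ (suc t mod n) + (n ∸ 1)) % n  ≡⟨ cong (λ r → (r + (n ∸ 1)) % n) (toℕ-mod (suc t)) ⟩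
      (suc t % n + (n ∸ 1)) % n          ≡⟨ %-remove-% (suc t) (n ∸ 1) n ⟩
      (suc t + (n ∸ 1)) % n              ≡⟨ cong (_% n) (sym (+-suc t (n ∸ 1))) ⟩
      (t + suc (n ∸ 1)) % n              ≡⟨ cong (λ m → (t + m) % n) (m+[n∸m]≡n (≤-trans (s≤s z≤n) 3≤n)) ⟩
      (t + n) % n                        ≡⟨ [m+n]%n≡m%n t n ⟩
      t % n                              ∎)
      where open ≡-Reasoning

  GeodesicallyJoined : Fin n → Fin n → Set
  GeodesicallyJoined u v = ∃ λ ps → IsGeodesic (Cycle n) u v ps × TotalRainbow vc ec ps

  BothWays : Fin n → Fin n → Set
  BothWays u v = GeodesicallyJoined u v × GeodesicallyJoined v u

  -- The same arc, listed upwards and downwards, serves both ordered pairs, because its colours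
  -- agree up to order.
  join : ∀ i d → suc d + suc d ≤ n → Unique (window C i d) → BothWays (i mod n) ((suc d + i) mod n)
  join i d 2d≤n u =
    (applyUpTo x (2 + d) ,
      ((Linked.applyUpTo⁺₂ x _ (λ t → inj₁ (Succ-mod (t + i))) ,
        Unique.applyUpTo⁺₁ x _ (λ a<b b<d → <⇒≢ a<b ∘ inj (<-trans a<b b<d) b<d) ,
        refl , last-applyUpTo x (suc d)) ,
       λ qs p → subst (_≤ pathLength qs) (sym (cong (_∸ 1) (length-applyUpTo x (2 + d))))
         (distance i (suc d) _ 2d≤n (map₁ proj₂ (path-is-arc i (suc d + i) p)))) ,
      Unique-resp-↭ (↭-sym (arc-colours C reads i d)) u) ,
    (applyDownFrom x (2 + d) ,
      ((Linked.applyDownFrom⁺₂ x _ (λ t → inj₂ (Succ-mod (t + i))) ,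
        Unique.applyDownFrom⁺₁ x _ (λ b<a a<d → <⇒≢ b<a ∘ sym ∘ inj a<d (<-trans b<a a<d)) ,
        refl , last-applyDownFrom x (suc d)) ,
       λ qs p → subst (_≤ pathLength qs) (sym (cong (_∸ 1) (length-applyDownFrom x (2 + d))))
         (distance i (suc d) _ 2d≤n (Sum.swap (map₁ proj₂ (path-is-arc (suc d + i) i p))))) ,
      Unique-resp-↭ (↭-sym (reversed-arc-colours C reads i d ec-sym)) u)
    where
    x : ℕ → Fin n
    x t = (t + i) mod n
    d<n : 2 + d ≤ n
    d<n = ≤-trans (+-monoʳ-≤ 1 (m≤n+m (suc d) d)) 2d≤n
    inj : ∀ {a b} → a < 2 + d → b < 2 + d → x a ≡ x b → a ≡ b
    inj a<d b<d = mod-injective i (<-≤-trans a<d d<n) (<-≤-trans b<d d<n)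

  module _ (balanced : Balanced n C) where

    n+u-mod : ∀ (u : Fin n) → (n + toℕ u) mod n ≡ u
    n+u-mod u = trans (mod-cong (trans (cong (_% n) (+-comm n (toℕ u))) ([m+n]%n≡m%n (toℕ u) n))) (toℕ-mod-inverse u)

    join-forward : ∀ u d → suc d + suc d ≤ n → BothWays u ((suc d + toℕ u) mod n)
    join-forward u d 2d≤n with balanced (Fin.toℕ<n u) (≤-trans (m≤m+n (suc d) (suc d)) 2d≤n) 2d≤n
    ... | inj₁ w        = subst (λ v → BothWays v ((suc d + toℕ u) mod n)) (toℕ-mod-inverse u) (join (toℕ u) d 2d≤n w)
    -- The pair is antipodal: the arc from the far end leads on to `u` in as many steps, and its
    -- reversal is taken.
    ... | inj₂ (eq , w) = swap (subst (BothWays ((suc d + toℕ u) mod n)) antipode (join (suc d + toℕ u) d 2d≤n w))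
      where
      antipode : (suc d + (suc d + toℕ u)) mod n ≡ u
      antipode = trans (cong (_mod n) (trans (sym (+-assoc (suc d) (suc d) (toℕ u))) (cong (_+ toℕ u) eq))) (n+u-mod u)

    join-< : ∀ u v → toℕ u < toℕ v → BothWays u v
    join-< u v u<v with d , d+u≡v ← offset u<v with 1+d+u≡v ← trans (sym (+-suc d (toℕ u))) d+u≡v
      with suc d + suc d ≤? n
    ... | yes 2d≤n = subst (BothWays u) (trans (cong (_mod n) 1+d+u≡v) (toℕ-mod-inverse v)) (join-forward u d 2d≤n)
    ... | no 2d≰n
      with e , e+d≡n ← offset (≤-<-trans (subst (suc d ≤_) 1+d+u≡v (m≤m+n (suc d) (toℕ u))) (Fin.toℕ<n v)) =
      swap (subst (BothWays v) around (join-forward v e 2e≤n))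
      where
      around : (suc e + toℕ v) mod n ≡ u
      around = trans (cong (_mod n) (begin
        suc e + toℕ v            ≡⟨ cong (suc e +_) 1+d+u≡v ⟨
        suc e + (suc d + toℕ u)  ≡⟨ +-assoc (suc e) (suc d) (toℕ u) ⟨
        suc e + suc d + toℕ u    ≡⟨ cong (_+ toℕ u) (+-suc e (suc d)) ⟨
        e + (2 + d) + toℕ u      ≡⟨ cong (_+ toℕ u) e+d≡n ⟩
        n + toℕ u                ∎)) (n+u-mod u)
        where open ≡-Reasoning
      2e≤n : suc e + suc e ≤ n
      2e≤n = ≤-trans (+-monoʳ-≤ (suc e) (<⇒≤ e<d)) (≤-reflexive e+d≡n′)
        where
        e+d≡n′ : suc e + suc d ≡ n
        e+d≡n′ = trans (sym (+-suc e (suc d))) e+d≡n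
        e<d : suc e < suc d
        e<d = +-cancelʳ-< (suc d) _ _ (subst (_< suc d + suc d) (sym e+d≡n′) (≰⇒> 2d≰n))

    strc : STRConnectedWith n (Cycle n) k
    strc = vc , ec , ec-sym , joined
      where
      joined : ∀ u v → ¬ u ≡ v → GeodesicallyJoined u v
      joined u v u≢v with <-cmp (toℕ u) (toℕ v)
      ... | tri< u<v _ _ = proj₁ (join-< u v u<v)
      ... | tri≈ _ u≡v _ = contradiction (Fin.toℕ-injective u≡v) u≢v
      ... | tri> _ _ v<u = proj₂ (join-< v u v<u)

-- Explicit colourings.

strc≤n : ∀ n → 3 ≤ n → STRConnectedWith n (Cycle n) n
strc≤n n@(suc _) 3≤n = Construction.strc 3≤n (_mod n) periodic
  λ {i} _ {d} _ 2d≤n → inj₁ (Unique.applyUpTo⁺₁ (λ p → (p + i * 2) mod n) (suc (d * 2)) λ a<b b<d →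
    let b<n = <-≤-trans b<d (≤-trans (small d) 2d≤n)
    in <⇒≢ a<b ∘ mod-injective (i * 2) (<-trans a<b b<n) b<n)
  where
  periodic : ∀ p → (p + n * 2) mod n ≡ p mod n
  periodic p = mod-cong {i = p + n * 2} {p} (%-remove-+ʳ p (m∣m*n 2))
  small : ∀ d → suc (d * 2) ≤ suc d + suc d
  small d = ≤-trans (n≤1+n _) (≤-reflexive (solve 1 (λ d → con 2 :+ d :* con 2 := con 1 :+ d :+ (con 1 :+ d)) refl d))

-- Entries follow the positions: edge {0, 1}, vertex 1, edge {1, 2}, and so on, ending with vertex
-- 0. In the tables used all entries are below `k`, so `mod k` merely casts them to `Fin k`.
table : ∀ {n} .{{_ : NonZero n}} k .{{_ : NonZero k}} → Vec ℕ n → ℕ → Fin k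
table {n} k cs p = Vec.lookup cs (p mod n) mod k

strc-table : ∀ n k .{{_ : NonZero n}} .{{_ : NonZero k}} .{{_ : NonZero (n * 2)}} (3≤n : 3 ≤ n) (cs : Vec ℕ (n * 2)) →
  {_ : True (balanced? n (table k cs))} → STRConnectedWith n (Cycle n) k
strc-table n k 3≤n cs {b} = Construction.strc 3≤n (table k cs)
  (λ p → cong (λ q → Vec.lookup cs q mod k) (mod-cong ([m+n]%n≡m%n p (n * 2)))) (toWitness b)

-- Both parameters at once.

strc⇒trc : ∀ {n k} → STRConnectedWith n (Cycle n) k → TRConnectedWith n (Cycle n) k
strc⇒trc (vc , ec , ec-sym , joined) = vc , ec , ec-sym , λ u v u≢v →
  let ps , (path , _) , rb = joined u v u≢v in ps , path , rb

-- Geodesics are paths, so trc is at most strc; a colouring for the stronger notion and a bound for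
-- the weaker one settle both.
common-minimum : ∀ {n v} → STRConnectedWith n (Cycle n) v → (∀ k → TRConnectedWith n (Cycle n) k → v ≤ k) →
  strcIs n (Cycle n) v × trcIs n (Cycle n) v
common-minimum s bound = (s , λ k → bound k ∘ strc⇒trc) , strc⇒trc s , bound

theorem3p3 : ∀ (n : ℕ) → 3 ≤ n →
    strcIs n (Cycle n) (cycleValue n) × trcIs n (Cycle n) (cycleValue n)
theorem3p3 1 (s≤s ())
theorem3p3 2 (s≤s (s≤s ()))
theorem3p3 3 3≤n = common-minimum
  (strc-table 3 1 3≤n (0 ∷ 0 ∷ 0 ∷ 0 ∷ 0 ∷ 0 ∷ []))
  -- In every case using `diameter-bound` the argument is ⌊n/2⌋ - 1, giving 2⌊n/2⌋ - 1 colours.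
  λ _ trc → LowerBounds.diameter-bound trc 0 (m≤m+n 2 1)
theorem3p3 4 3≤n = common-minimum
  (strc-table 4 3 3≤n (0 ∷ 0 ∷ 0 ∷ 0 ∷ 0 ∷ 1 ∷ 2 ∷ 1 ∷ []))
  λ _ trc → LowerBounds.diameter-bound trc 1 (m≤m+n 4 0)
theorem3p3 5 3≤n = common-minimum
  (strc-table 5 3 3≤n (0 ∷ 1 ∷ 2 ∷ 0 ∷ 1 ∷ 0 ∷ 2 ∷ 0 ∷ 1 ∷ 2 ∷ []))
  λ _ trc → LowerBounds.diameter-bound trc 1 (m≤m+n 4 1)
theorem3p3 6 3≤n = common-minimum
  (strc-table 6 5 3≤n (0 ∷ 1 ∷ 2 ∷ 0 ∷ 1 ∷ 0 ∷ 3 ∷ 0 ∷ 1 ∷ 2 ∷ 4 ∷ 3 ∷ []))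
  λ _ trc → LowerBounds.diameter-bound trc 2 (m≤m+n 6 0)
theorem3p3 7 3≤n = common-minimum
  (strc-table 7 6 3≤n (0 ∷ 1 ∷ 2 ∷ 3 ∷ 4 ∷ 0 ∷ 1 ∷ 2 ∷ 3 ∷ 0 ∷ 4 ∷ 1 ∷ 5 ∷ 3 ∷ []))
  λ _ → trc-C₇
theorem3p3 8 3≤n = common-minimum
  (strc-table 8 7 3≤n (0 ∷ 1 ∷ 2 ∷ 3 ∷ 4 ∷ 0 ∷ 1 ∷ 3 ∷ 5 ∷ 0 ∷ 2 ∷ 1 ∷ 3 ∷ 4 ∷ 6 ∷ 5 ∷ []))
  λ _ trc → LowerBounds.diameter-bound trc 3 (m≤m+n 8 0)
theorem3p3 9 3≤n = common-minimum
  (strc-table 9 8 3≤n (0 ∷ 1 ∷ 2 ∷ 3 ∷ 4 ∷ 5 ∷ 6 ∷ 0 ∷ 7 ∷ 3 ∷ 1 ∷ 5 ∷ 2 ∷ 4 ∷ 6 ∷ 3 ∷ 7 ∷ 5 ∷ []))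
  λ _ → trc-C₉
theorem3p3 10 3≤n = common-minimum
  (strc-table 10 9 3≤n (0 ∷ 1 ∷ 2 ∷ 3 ∷ 4 ∷ 5 ∷ 6 ∷ 0 ∷ 1 ∷ 7 ∷ 8 ∷ 2 ∷ 3 ∷ 0 ∷ 4 ∷ 1 ∷ 5 ∷ 6 ∷ 7 ∷ 8 ∷ []))
  λ _ trc → LowerBounds.diameter-bound trc 4 (m≤m+n 10 0)
theorem3p3 11 3≤n = common-minimum (strc≤n 11 3≤n)
  -- With d = 4 the conditions read 10 < 11 < 12.
  λ _ trc → LowerBounds.sparse-bound trc 4 (m≤m+n 11 0) (m≤m+n 12 0)
theorem3p3 12 3≤n = common-minimum
  (strc-table 12 11 3≤n (0 ∷ 1 ∷ 2 ∷ 3 ∷ 4 ∷ 5 ∷ 6 ∷ 7 ∷ 8 ∷ 1 ∷ 9 ∷ 3 ∷ 0 ∷ 10 ∷ 2 ∷ 4 ∷ 5 ∷ 1 ∷ 6 ∷ 3 ∷ 7 ∷ 8 ∷ 9 ∷ 10 ∷ []))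
  λ _ trc → LowerBounds.diameter-bound trc 5 (m≤m+n 12 0)
theorem3p3 n@(2+ (2+ (2+ (2+ (2+ (2+ (suc m))))))) 3≤n = common-minimum (strc≤n n 3≤n) bound
  where
  2d<n : ∀ t → suc (5 + t) + suc (5 + t) ≡ 12 + t * 2
  2d<n = solve 1 (λ t → con 6 :+ t :+ (con 6 :+ t) := con 12 :+ t :* con 2) refl
  3d : ∀ t → 3 * (5 + t) ≡ 15 + t * 2 + t
  3d = solve 1 (λ t → con 3 :* (con 5 :+ t) := con 15 :+ t :* con 2 :+ t) refl
  bound : ∀ k → TRConnectedWith n (Cycle n) k → n ≤ k
  -- Here n = 13 + m, and 5 + t is the largest d with 2(d + 1) < n for either parity of m; then 3d =
  -- 15 + 3t exceeds n ≤ 14 + 2t.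
  bound k trc with halve m
  ... | t , inj₁ refl = LowerBounds.sparse-bound trc (5 + t)
    (s≤s (≤-reflexive (2d<n t))) (subst (n <_) (sym (3d t)) (≤-trans (n≤1+n _) (m≤m+n _ t)))
  ... | t , inj₂ refl = LowerBounds.sparse-bound trc (5 + t)
    (s≤s (≤-trans (≤-reflexive (2d<n t)) (n≤1+n _))) (subst (n <_) (sym (3d t)) (m≤m+n _ t))
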